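{- Let $n\ge2$, let $G$ be a connected graph on $V=\{0,1,\dots,n\}$ with root $0$, let $e_0$ be an edge of $G$ joining the root $0$ to the vertex $n$, and let $G'=G-\{e_0\}$. Then \[ \mathcal{M}_{G'}=(\mathcal{M}_G:x_n)=\{z\in R: z\cdot x_n\in\mathcal{M}_G\}. \] Further, multiplication by $x_n$ induces a bijection \[ \mu_{x_n}:\{\mathbf{x}^{\mathcal{P}}:\mathcal{P}\in\mathrm{sPF}(G')\}\longrightarrow\{\mathbf{x}^{\mathcal{P}}:\mathcal{P}\in\mathrm{sPF}(G)\}. \] In particular, $|\mathrm{sPF}(G)|=|\mathrm{sPF}(G')|$.
   Context: $\mathbb{N}=\{0,1,2,\dots\}$, $[n]=\{1,\dots,n\}$; graphs are undirected and loopless, multiple edges allowed; $G-\{e_0\}$ is obtained by deleting the single edge $e_0$ (it need not be connected). $R=\mathbb{K}[x_1,\dots,x_n]$ over a field $\mathbb{K}$. For a graph $G$ on $V$ (connected or not) with $a_{ij}$ edges between $i$ and $j$, and $\emptyset\ne A\subseteq[n]$, put $d_A(i)=\sum_{j\in V\setminus A}a_{ij}$ and $m_A=\prod_{i\in A}x_i^{d_A(i)}$. Let $\mathcal{M}_G=\langle m_A:\emptyset\neq A\subseteq[n]\rangle$ and $\mathcal{M}_G^{(k)}=\langle m_A:\emptyset\ne A\subseteq[n],\ |A|\le k+1\rangle$ for $0\le k\le n-1$. The set of spherical $G$-parking functions is $\mathrm{sPF}(G)=\{\mathcal{P}=(p_1,\dots,p_n)\in\mathbb{N}^n:\ \mathbf{x}^{\mathcal{P}}=\prod_i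 x_i^{p_i}\in\mathcal{M}_G\setminus\mathcal{M}_G^{(n-2)}\}$. -}

module Defs where

open import Algebra.Apartness.Bundles using (HeytingField; HeytingCommutativeRing)
open import Algebra.Bundles using (CommutativeRing)
import Algebra.Properties.AbelianGroup as AbelianGroupProperties
open import Data.Bool.Base using (if_then_else_)
open import Data.Fin.Base using (Fin; zero; suc; fromℕ)
import Data.Fin.Properties as Fin
open import Data.Fin.Subset using (Subset; outside; Nonempty; ∣_∣; ∁)
open import Data.Fin.Subset.Properties using () renaming (_∈?_ to _∈ˢ?_)
open import Data.List.Base as List using (List; []; _∷_; _++_; length; filter; map; allFin; removeAt; cartesianProductWith)
import Data.List.Properties as List
open import Data.List.Relation.Unary.Any using (Any)
open import Data.Nat.Base using (ℕ; suc; _≤_; s≤s; _∸_)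
import Data.Nat.Base as ℕ
import Data.Nat.ListAction as ℕ
import Data.Nat.Properties as ℕ
open import Data.Product.Base using (Σ; ∃; ∃-syntax; _×_; _,_; proj₁; proj₂; map₁)
open import Data.Sum.Base using (_⊎_)
open import Data.Vec.Base as Vec using (Vec; []; _∷_; replicate; tabulate; zipWith)
import Data.Vec.Properties as Vec
open import Function.Bundles using (Bijection)
open import Level using (_⊔_)
open import Relation.Binary.Bundles using (Setoid)
import Relation.Binary.Construct.On as On
open import Relation.Binary.Construct.Closure.ReflexiveTransitive using (Star)
open import Relation.Binary.PropositionalEquality as ≡ using (_≡_; _≢_; refl; cong; cong₂)
open import Relation.Nullary.Decidable using (Dec; yes; no; does; _×-dec_; _⊎-dec_)
open import Relation.Nullary.Negation using (¬_; contradiction)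
open import Relation.Unary using (Pred; _∈_; _∉_)

subsetSetoid : ∀ {a ℓ p} (S : Setoid a ℓ) → Pred (Setoid.Carrier S) p → Setoid (a ⊔ p) ℓ
subsetSetoid S P = On.setoid {B = Σ (Setoid.Carrier S) P} S proj₁

HasCardinality : ∀ {a p} {A : Set a} → Pred A p → ℕ → Set (a ⊔ p)
HasCardinality {A = A} P k = Bijection (subsetSetoid (≡.setoid A) P) (≡.setoid (Fin k))

-- Graphs on V = {0,…,n} are on Fin (suc n).  The set [n] of non-root vertices
-- is Fin n, an index i : Fin n standing for the vertex suc i.

root : ∀ {n} → Fin (suc n)
root = zero

vertex : ∀ {n} → Fin n → Fin (suc n)
vertex = suc

last : ∀ {n} → 2 ≤ n → Fin n
last {suc m} _ = fromℕ m

vertex-last : ∀ {n} (2≤n : 2 ≤ n) → vertex (last 2≤n) ≡ fromℕ n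
vertex-last (s≤s _) = refl

-- An undirected non-loop edge; the order in which its ends are listed carries
-- no meaning and is ignored by Joins.
record Edge (n : ℕ) : Set where
  field
    end₁ end₂ : Fin (suc n)
    loopless  : end₁ ≢ end₂

open Edge public

Joins : ∀ {n} → Fin (suc n) → Fin (suc n) → Edge n → Set
Joins u v e = (end₁ e ≡ u × end₂ e ≡ v) ⊎ (end₁ e ≡ v × end₂ e ≡ u)

joins? : ∀ {n} (u v : Fin (suc n)) (e : Edge n) → Dec (Joins u v e)
joins? u v e = ((end₁ e Fin.≟ u) ×-dec (end₂ e Fin.≟ v))
         ⊎-dec ((end₁ e Fin.≟ v) ×-dec (end₂ e Fin.≟ u))

-- Parallel edges are distinct positions of the list.
record Multigraph (n : ℕ) : Set where
  constructor mkMultigraph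
  field
    edges : List (Edge n)

  EdgeIndex : Set
  EdgeIndex = Fin (length edges)

  edge : EdgeIndex → Edge n
  edge = List.lookup edges

open Multigraph public

infixl 6 _-ₑ_

_-ₑ_ : ∀ {n} (G : Multigraph n) → EdgeIndex G → Multigraph n
G -ₑ e = mkMultigraph (removeAt (edges G) e)

Adjacent : ∀ {n} → Multigraph n → Fin (suc n) → Fin (suc n) → Set
Adjacent G u v = Any (Joins u v) (edges G)

Connected : ∀ {n} → Multigraph n → Set
Connected G = ∀ u v → Star (Adjacent G) u v

a : ∀ {n} → Multigraph n → Fin (suc n) → Fin (suc n) → ℕ
a G u v = length (filter (joins? u v) (edges G))

-- A ⊆ [n] viewed inside V is outside ∷ A, so the sum ranges over V ∖ A, root included.
d : ∀ {n} → Multigraph n → Subset n → Fin n → ℕ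
d {n} G A i =
  ℕ.sum (map (a G (vertex i)) (filter (_∈ˢ? ∁ (outside ∷ A)) (allFin (suc n))))

mExponent : ∀ {n} → Multigraph n → Subset n → Vec ℕ n
mExponent G A = tabulate λ i → if does (i ∈ˢ? A) then d G A i else 0

module Ideals {c ℓ} (R : CommutativeRing c ℓ) where
  open CommutativeRing R

  data ⟨_⟩ {p} (S : Pred Carrier p) : Pred Carrier (c ⊔ ℓ ⊔ p) where
    ⟨⟩-gen  : ∀ {x} → x ∈ S → x ∈ ⟨ S ⟩
    ⟨⟩-0    : 0# ∈ ⟨ S ⟩
    ⟨⟩-+    : ∀ {x y} → x ∈ ⟨ S ⟩ → y ∈ ⟨ S ⟩ → (x + y) ∈ ⟨ S ⟩
    ⟨⟩-*    : ∀ r {x} → x ∈ ⟨ S ⟩ → (r * x) ∈ ⟨ S ⟩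
    ⟨⟩-resp : ∀ {x y} → x ≈ y → x ∈ ⟨ S ⟩ → y ∈ ⟨ S ⟩

  infix 6 _∶_

  _∶_ : ∀ {p} → Pred Carrier p → Carrier → Pred Carrier p
  (I ∶ x) z = (z * x) ∈ I

infixl 6 _⊕_

_⊕_ : ∀ {n} → Vec ℕ n → Vec ℕ n → Vec ℕ n
_⊕_ = zipWith ℕ._+_

_≟ᵉ_ : ∀ {n} (e f : Vec ℕ n) → Dec (e ≡ f)
_≟ᵉ_ = Vec.≡-dec ℕ._≟_

module PolynomialRing {c ℓ} (K : CommutativeRing c ℓ) (n : ℕ) where
  private
    module K = CommutativeRing K
    module KP = AbelianGroupProperties K.+-abelianGroup

  Exponent : Set
  Exponent = Vec ℕ n

  Term : Set c
  Term = K.Carrier × Exponent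

  -- A polynomial is a formal finite sum of terms, possibly with repeated
  -- exponents and zero coefficients; equality compares coefficients.
  Poly : Set c
  Poly = List Term

  coeff : Poly → Exponent → K.Carrier
  coeff []            e = K.0#
  coeff ((k , f) ∷ p) e = (if does (f ≟ᵉ e) then k else K.0#) K.+ coeff p e

  infix 4 _≈ᴾ_

  record _≈ᴾ_ (p q : Poly) : Set ℓ where
    constructor mk≈
    field
      coeff-≈ : ∀ e → coeff p e K.≈ coeff q e

  open _≈ᴾ_ public

  _*ᵀ_ : Term → Term → Term
  (k , e) *ᵀ (l , f) = (k K.* l , e ⊕ f)

  infixl 6 _+ᴾ_
  infixl 7 _*ᴾ_

  _+ᴾ_ : Poly → Poly → Poly
  _+ᴾ_ = _++_

  _*ᴾ_ : Poly → Poly → Poly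
  _*ᴾ_ = cartesianProductWith _*ᵀ_

  -ᴾ_ : Poly → Poly
  -ᴾ_ = map (map₁ (λ k → K.- k))

  𝟎 : Exponent
  𝟎 = replicate n 0

  0ᴾ 1ᴾ : Poly
  0ᴾ = []
  1ᴾ = (K.1# , 𝟎) ∷ []

  x^_ : Exponent → Poly
  x^ e = (K.1# , e) ∷ []

  var : Fin n → Poly
  var i = x^ (𝟎 Vec.[ i ]≔ 1)

  open import Relation.Binary.Reasoning.Setoid K.setoid

  infix 4 _~_
  _~_ : Term → Term → Set ℓ
  (k , e) ~ (l , f) = (k K.≈ l) × (e ≡ f)

  δ : Term → Exponent → K.Carrier
  δ (k , f) e = if does (f ≟ᵉ e) then k else K.0#

  δ-cong : ∀ {s t} → s ~ t → ∀ e → δ s e K.≈ δ t e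
  δ-cong {k , f} (k≈l , refl) e with f ≟ᵉ e
  ... | yes _ = k≈l
  ... | no _  = K.refl

  coeff-++ : ∀ p q e → coeff (p ++ q) e K.≈ coeff p e K.+ coeff q e
  coeff-++ []      q e = K.sym (K.+-identityˡ _)
  coeff-++ (t ∷ p) q e = begin
    δ t e K.+ coeff (p ++ q) e              ≈⟨ K.+-congˡ (coeff-++ p q e) ⟩
    δ t e K.+ (coeff p e K.+ coeff q e)     ≈⟨ K.+-assoc _ _ _ ⟨
    (δ t e K.+ coeff p e) K.+ coeff q e     ∎

  coeff-map : ∀ {f g : Term → Term} → (∀ t → f t ~ g t) →
              ∀ p e → coeff (map f p) e K.≈ coeff (map g p) e
  coeff-map f~g []      e = K.refl
  coeff-map f~g (t ∷ p) e = K.+-cong (δ-cong (f~g t) e) (coeff-map f~g p e)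

  ⊕-assoc : ∀ {m} (e f g : Vec ℕ m) → (e ⊕ f) ⊕ g ≡ e ⊕ (f ⊕ g)
  ⊕-assoc = Vec.zipWith-assoc ℕ.+-assoc

  ⊕-comm : ∀ {m} (e f : Vec ℕ m) → e ⊕ f ≡ f ⊕ e
  ⊕-comm = Vec.zipWith-comm ℕ.+-comm

  ⊕-identityˡ : ∀ {m} (e : Vec ℕ m) → replicate m 0 ⊕ e ≡ e
  ⊕-identityˡ = Vec.zipWith-identityˡ ℕ.+-identityˡ

  ⊕-cancelˡ : ∀ {m} (e f g : Vec ℕ m) → e ⊕ f ≡ e ⊕ g → f ≡ g
  ⊕-cancelˡ []      []      []      _  = refl
  ⊕-cancelˡ (x ∷ e) (y ∷ f) (z ∷ g) eq = cong₂ _∷_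
    (ℕ.+-cancelˡ-≡ x y z (Vec.∷-injectiveˡ eq)) (⊕-cancelˡ e f g (Vec.∷-injectiveʳ eq))

  subtract? : ∀ {m} (f e : Vec ℕ m) → Dec (∃ λ g → f ⊕ g ≡ e)
  subtract? []      []      = yes ([] , refl)
  subtract? (x ∷ f) (y ∷ e) with x ℕ.≤? y | subtract? f e
  ... | yes x≤y | yes (g , eq) = yes (y ∸ x ∷ g , cong₂ _∷_ (ℕ.m+[n∸m]≡n x≤y) eq)
  ... | no x≰y  | _            = no λ where
    (z ∷ g , refl) → x≰y (ℕ.m≤m+n x z)
  ... | yes _   | no ¬∃        = no λ where
    (z ∷ g , eq) → ¬∃ (g , Vec.∷-injectiveʳ eq)

  coeff-scale : ∀ k f q g → coeff (map ((k , f) *ᵀ_) q) (f ⊕ g) K.≈ k K.* coeff q g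
  coeff-scale k f []            g = K.sym (K.zeroʳ k)
  coeff-scale k f ((l , h) ∷ q) g = begin
    δ (k K.* l , f ⊕ h) (f ⊕ g) K.+ coeff (map ((k , f) *ᵀ_) q) (f ⊕ g)
      ≈⟨ K.+-cong shift (coeff-scale k f q g) ⟩
    k K.* δ (l , h) g K.+ k K.* coeff q g
      ≈⟨ K.distribˡ _ _ _ ⟨
    k K.* (δ (l , h) g K.+ coeff q g) ∎
    where
    shift : δ (k K.* l , f ⊕ h) (f ⊕ g) K.≈ k K.* δ (l , h) g
    shift with h ≟ᵉ g | (f ⊕ h) ≟ᵉ (f ⊕ g)
    ... | yes _    | yes _ = K.refl
    ... | no _     | no _  = K.sym (K.zeroʳ k)
    ... | yes refl | no ≢  = contradiction refl ≢
    ... | no ≢     | yes ≡ = contradiction (⊕-cancelˡ f h g ≡) ≢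

  coeff-scale-0 : ∀ k f q e → ¬ (∃ λ g → f ⊕ g ≡ e) →
                  coeff (map ((k , f) *ᵀ_) q) e K.≈ K.0#
  coeff-scale-0 k f []            e ¬∃ = K.refl
  coeff-scale-0 k f ((l , h) ∷ q) e ¬∃ with (f ⊕ h) ≟ᵉ e
  ... | yes eq = contradiction (h , eq) ¬∃
  ... | no _   = K.trans (K.+-identityˡ _) (coeff-scale-0 k f q e ¬∃)

  private
    scale-cong : ∀ t {p q} → p ≈ᴾ q → map (t *ᵀ_) p ≈ᴾ map (t *ᵀ_) q
    scale-cong (k , f) {p} {q} p≈q .coeff-≈ e with subtract? f e
    ... | yes (g , refl) = begin
      coeff (map ((k , f) *ᵀ_) p) (f ⊕ g) ≈⟨ coeff-scale k f p g ⟩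
      k K.* coeff p g                     ≈⟨ K.*-congˡ (coeff-≈ p≈q g) ⟩
      k K.* coeff q g                     ≈⟨ coeff-scale k f q g ⟨
      coeff (map ((k , f) *ᵀ_) q) (f ⊕ g) ∎
    ... | no ¬∃ = K.trans (coeff-scale-0 k f p e ¬∃) (K.sym (coeff-scale-0 k f q e ¬∃))

    ≈-refl : ∀ {p} → p ≈ᴾ p
    ≈-refl .coeff-≈ e = K.refl

    ≈-sym : ∀ {p q} → p ≈ᴾ q → q ≈ᴾ p
    ≈-sym p≈q .coeff-≈ e = K.sym (coeff-≈ p≈q e)

    ≈-trans : ∀ {p q r} → p ≈ᴾ q → q ≈ᴾ r → p ≈ᴾ r
    ≈-trans p≈q q≈r .coeff-≈ e = K.trans (coeff-≈ p≈q e) (coeff-≈ q≈r e)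

    ≡⇒≈ : ∀ {p q} → p ≡ q → p ≈ᴾ q
    ≡⇒≈ refl = ≈-refl

    +-cong : ∀ {p q r s} → p ≈ᴾ q → r ≈ᴾ s → (p +ᴾ r) ≈ᴾ (q +ᴾ s)
    +-cong {p} {q} {r} {s} p≈q r≈s .coeff-≈ e = begin
      coeff (p ++ r) e          ≈⟨ coeff-++ p r e ⟩
      coeff p e K.+ coeff r e   ≈⟨ K.+-cong (coeff-≈ p≈q e) (coeff-≈ r≈s e) ⟩
      coeff q e K.+ coeff s e   ≈⟨ coeff-++ q s e ⟨
      coeff (q ++ s) e          ∎

    +-comm : ∀ p q → (p +ᴾ q) ≈ᴾ (q +ᴾ p)
    +-comm p q .coeff-≈ e = begin
      coeff (p ++ q) e          ≈⟨ coeff-++ p q e ⟩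
      coeff p e K.+ coeff q e   ≈⟨ K.+-comm _ _ ⟩
      coeff q e K.+ coeff p e   ≈⟨ coeff-++ q p e ⟨
      coeff (q ++ p) e          ∎

    coeff-neg : ∀ p e → coeff (-ᴾ p) e K.≈ K.- coeff p e
    coeff-neg []            e = K.sym KP.ε⁻¹≈ε
    coeff-neg ((k , f) ∷ p) e = begin
      δ (K.- k , f) e K.+ coeff (-ᴾ p) e    ≈⟨ K.+-cong δ-neg (coeff-neg p e) ⟩
      K.- δ (k , f) e K.+ K.- coeff p e     ≈⟨ KP.⁻¹-∙-comm _ _ ⟩
      K.- (δ (k , f) e K.+ coeff p e)       ∎
      where
      δ-neg : δ (K.- k , f) e K.≈ K.- δ (k , f) e
      δ-neg with f ≟ᵉ e
      ... | yes _ = K.refl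
      ... | no _  = K.sym KP.ε⁻¹≈ε

    -‿cong : ∀ {p q} → p ≈ᴾ q → (-ᴾ p) ≈ᴾ (-ᴾ q)
    -‿cong {p} {q} p≈q .coeff-≈ e = begin
      coeff (-ᴾ p) e   ≈⟨ coeff-neg p e ⟩
      K.- coeff p e    ≈⟨ K.-‿cong (coeff-≈ p≈q e) ⟩
      K.- coeff q e    ≈⟨ coeff-neg q e ⟨
      coeff (-ᴾ q) e   ∎

    +-inverseʳ : ∀ p → (p +ᴾ (-ᴾ p)) ≈ᴾ 0ᴾ
    +-inverseʳ p .coeff-≈ e = begin
      coeff (p ++ -ᴾ p) e             ≈⟨ coeff-++ p (-ᴾ p) e ⟩
      coeff p e K.+ coeff (-ᴾ p) e    ≈⟨ K.+-congˡ (coeff-neg p e) ⟩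
      coeff p e K.+ K.- coeff p e     ≈⟨ K.-‿inverseʳ _ ⟩
      K.0#                            ∎

    *-congˡ : ∀ p {q r} → q ≈ᴾ r → (p *ᴾ q) ≈ᴾ (p *ᴾ r)
    *-congˡ []      q≈r = ≈-refl
    *-congˡ (t ∷ p) q≈r = +-cong (scale-cong t q≈r) (*-congˡ p q≈r)

    *-zeroʳ : ∀ p → p *ᴾ [] ≡ []
    *-zeroʳ []      = refl
    *-zeroʳ (t ∷ p) = *-zeroʳ p

    *-∷ʳ : ∀ p t q → (p *ᴾ (t ∷ q)) ≈ᴾ (map (t *ᵀ_) p +ᴾ p *ᴾ q)
    *-∷ʳ []      t q = ≈-refl
    *-∷ʳ (s ∷ p) t q .coeff-≈ e = begin
      δ (s *ᵀ t) e K.+ coeff (map (s *ᵀ_) q ++ p *ᴾ (t ∷ q)) e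
        ≈⟨ K.+-cong (δ-cong {s *ᵀ t} {t *ᵀ s} (K.*-comm _ _ , ⊕-comm (proj₂ s) (proj₂ t)) e) (begin
             coeff (sq ++ p *ᴾ (t ∷ q)) e    ≈⟨ coeff-≈ (+-cong {sq} ≈-refl (*-∷ʳ p t q)) e ⟩
             coeff (sq ++ (tp ++ pq)) e      ≡⟨ cong (λ r → coeff r e) (List.++-assoc sq tp pq) ⟨
             coeff ((sq ++ tp) ++ pq) e      ≈⟨ coeff-≈ (+-cong (+-comm sq tp) (≈-refl {pq})) e ⟩
             coeff ((tp ++ sq) ++ pq) e      ≡⟨ cong (λ r → coeff r e) (List.++-assoc tp sq pq) ⟩
             coeff (tp ++ (sq ++ pq)) e      ∎) ⟩
      δ (t *ᵀ s) e K.+ coeff (tp ++ (sq ++ pq)) e ∎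
      where
      sq tp pq : Poly
      sq = map (s *ᵀ_) q
      tp = map (t *ᵀ_) p
      pq = p *ᴾ q

    *-comm : ∀ p q → (p *ᴾ q) ≈ᴾ (q *ᴾ p)
    *-comm p []      = ≡⇒≈ (*-zeroʳ p)
    *-comm p (t ∷ q) = ≈-trans (*-∷ʳ p t q) (+-cong {map (t *ᵀ_) p} ≈-refl (*-comm p q))

    *-cong : ∀ {p q r s} → p ≈ᴾ q → r ≈ᴾ s → (p *ᴾ r) ≈ᴾ (q *ᴾ s)
    *-cong {p} {q} {r} {s} p≈q r≈s =
      ≈-trans (*-congˡ p r≈s) (≈-trans (*-comm p s) (≈-trans (*-congˡ s p≈q) (*-comm s q)))

    *-distribʳ : ∀ r p q → (p ++ q) *ᴾ r ≡ p *ᴾ r ++ q *ᴾ r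
    *-distribʳ r []      q = refl
    *-distribʳ r (t ∷ p) q = ≡.trans (cong (map (t *ᵀ_) r ++_) (*-distribʳ r p q))
                                     (≡.sym (List.++-assoc (map (t *ᵀ_) r) _ _))

    *-distribˡ : ∀ p q r → (p *ᴾ (q +ᴾ r)) ≈ᴾ (p *ᴾ q +ᴾ p *ᴾ r)
    *-distribˡ p q r = ≈-trans (*-comm p (q ++ r))
      (≈-trans (≡⇒≈ (*-distribʳ p q r)) (+-cong (*-comm q p) (*-comm r p)))

    scale-* : ∀ t q r → (map (t *ᵀ_) q *ᴾ r) ≈ᴾ map (t *ᵀ_) (q *ᴾ r)
    scale-* t []      r = ≈-refl
    scale-* t (s ∷ q) r = ≈-trans (+-cong scale-scale (scale-* t q r))
      (≡⇒≈ (≡.sym (List.map-++ (t *ᵀ_) (map (s *ᵀ_) r) (q *ᴾ r))))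
      where
      scale-scale : map ((t *ᵀ s) *ᵀ_) r ≈ᴾ map (t *ᵀ_) (map (s *ᵀ_) r)
      scale-scale = ≈-trans
        (mk≈ (coeff-map (λ _ → K.*-assoc _ _ _ , ⊕-assoc _ _ _) r))
        (≡⇒≈ (List.map-∘ r))

    *-assoc : ∀ p q r → ((p *ᴾ q) *ᴾ r) ≈ᴾ (p *ᴾ (q *ᴾ r))
    *-assoc []      q r = ≈-refl
    *-assoc (t ∷ p) q r = ≈-trans (≡⇒≈ (*-distribʳ r (map (t *ᵀ_) q) (p *ᴾ q)))
      (+-cong (scale-* t q r) (*-assoc p q r))

    *-identityˡ : ∀ p → (1ᴾ *ᴾ p) ≈ᴾ p
    *-identityˡ p = ≈-trans (≡⇒≈ (List.++-identityʳ _)) (≈-trans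
      (mk≈ (coeff-map {g = λ t → t} (λ _ → K.*-identityˡ _ , ⊕-identityˡ _) p))
      (≡⇒≈ (List.map-id p)))

  ring : CommutativeRing c ℓ
  ring = record
    { Carrier = Poly
    ; _≈_ = _≈ᴾ_
    ; _+_ = _+ᴾ_
    ; _*_ = _*ᴾ_
    ; -_ = -ᴾ_
    ; 0# = 0ᴾ
    ; 1# = 1ᴾ
    ; isCommutativeRing = record
      { isRing = record
        { +-isAbelianGroup = record
          { isGroup = record
            { isMonoid = record
              { isSemigroup = record
                { isMagma = record
                  { isEquivalence = record { refl = ≈-refl ; sym = ≈-sym ; trans = ≈-trans }
                  ; ∙-cong = +-cong }
                ; assoc = λ p q r → ≡⇒≈ (List.++-assoc p q r) }
              ; identity = (λ _ → ≈-refl) , (λ p → ≡⇒≈ (List.++-identityʳ p)) }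
            ; inverse = (λ p → ≈-trans (+-comm (-ᴾ p) p) (+-inverseʳ p)) , +-inverseʳ
            ; ⁻¹-cong = -‿cong }
          ; comm = +-comm }
        ; *-cong = *-cong
        ; *-assoc = *-assoc
        ; *-identity = *-identityˡ , (λ p → ≈-trans (*-comm p 1ᴾ) (*-identityˡ p))
        ; distrib = *-distribˡ , (λ r p q → ≡⇒≈ (*-distribʳ r p q))
        }
      ; *-comm = *-comm
      }
    }

-- HeytingField is the library's notion of field: its axioms make the units
-- exactly the elements apart from 0, and force 1 # 0.
module Parking {c ℓ₁ ℓ₂} (𝕂 : HeytingField c ℓ₁ ℓ₂) (n : ℕ) where
  open PolynomialRing (HeytingCommutativeRing.commutativeRing (HeytingField.heytingCommutativeRing 𝕂)) n public

  R : CommutativeRing c ℓ₁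
  R = ring

  open Ideals R public

  m : Multigraph n → Subset n → Poly
  m G A = x^ (mExponent G A)

  𝓜 : Multigraph n → Pred Poly (c ⊔ ℓ₁)
  𝓜 G = ⟨ (λ z → ∃[ A ] Nonempty A × z ≡ m G A) ⟩

  𝓜⁽_⁾ : ℕ → Multigraph n → Pred Poly (c ⊔ ℓ₁)
  𝓜⁽ k ⁾ G = ⟨ (λ z → ∃[ A ] Nonempty A × ∣ A ∣ ≤ suc k × z ≡ m G A) ⟩

  -- Used for n ≥ 2 only, where n ∸ 2 is the true difference.
  sPF : Multigraph n → Pred Exponent (c ⊔ ℓ₁)
  sPF G P = (x^ P) ∈ 𝓜 G × (x^ P) ∉ 𝓜⁽ n ∸ 2 ⁾ G

  monomials : ∀ {p} → Pred Exponent p → Pred Poly (ℓ₁ ⊔ p)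
  monomials S z = ∃[ P ] P ∈ S × z ≈ᴾ (x^ P)

  monomialSetoid : ∀ {p} → Pred Exponent p → Setoid (c ⊔ ℓ₁ ⊔ p) ℓ₁
  monomialSetoid S = subsetSetoid (CommutativeRing.setoid R) (monomials S)

{-# OPTIONS --safe #-}
-- A polynomial lies in a monomial ideal iff its coefficients vanish at every
-- exponent not dominating a generator; domination is decidable, so no decidable
-- equality on the field is needed.  Deleting e₀ lowers the exponent of xₙ in m_A
-- by one if n ∈ A and changes nothing else; if n ∉ A then xₙ does not occur in m_A.
-- Hence m_A ∣ xₙ·x^P for G iff m_A ∣ x^P for G′, for each A separately, which gives the
-- colon formula for 𝓜 and for 𝓜⁽ⁿ⁻²⁾ alike.  For P ∈ sPF(G) only m_[n] divides x^P,
-- and xₙ divides m_[n] because of e₀, so every element of sPF(G) comes from sPF(G′).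
-- Finiteness: the generators m_{i} bound P_i.
module Submission where

open import Defs
open import Algebra.Apartness.Bundles using (HeytingField; HeytingCommutativeRing)
open import Algebra.Bundles using (CommutativeRing)
import Algebra.Apartness.Properties.HeytingCommutativeRing as HeytingProperties
open import Data.Bool.Base using (if_then_else_)
open import Data.Fin.Base using (Fin; zero; suc)
import Data.Fin.Properties as Fin
open import Data.Fin.Subset using (Subset; outside; Nonempty; ∣_∣; ∁; ⁅_⁆; _∈_; _∉_)
open import Data.Fin.Subset.Properties using (_∈?_; nonempty?; anySubset?; ∣⁅x⁆∣≡1; x∈⁅x⁆; x∈⁅y⁆⇒x≡y; ∈⊤; ⊆⊤; p⊂q⇒∣p∣<∣q∣; ∣⊤∣≡n)
open import Data.List.Base as List using (List; []; _∷_; length; filter; map; allFin; removeAt; cartesianProductWith; upTo)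
import Data.List.Properties as List
open import Data.List.Membership.Propositional using () renaming (_∈_ to _∈ˡ_)
open import Data.List.Membership.Propositional.Properties using (∈-filter⁺; ∈-filter⁻; ∈-cartesianProductWith⁺; ∈-upTo⁺; ∈-lookup)
open import Data.List.Relation.Unary.All as All using (All; []; _∷_)
import Data.List.Relation.Unary.All.Properties as All
open import Data.List.Relation.Unary.Any using (index; here)
open import Data.List.Relation.Unary.Any.Properties using (lookup-index)
open import Data.List.Relation.Unary.AllPairs using ([]; _∷_)
open import Data.List.Relation.Unary.Unique.Propositional using (Unique)
import Data.List.Relation.Unary.Unique.Propositional.Properties as Unique
open import Data.Nat.Base using (ℕ; zero; suc; _+_; _∸_; _≤_; _<_; z≤n; s≤s; s≤s⁻¹)
import Data.Nat.ListAction as ℕ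
import Data.Nat.Properties as ℕ
open import Data.Product.Base using (_×_; _,_; proj₁; proj₂; ∃; Σ-syntax; ∃-syntax)
open import Data.Sum.Base using (_⊎_; inj₁; inj₂; swap)
open import Data.Vec.Base as Vec using (Vec; []; _∷_; lookup; replicate; _[_]≔_)
import Data.Vec.Properties as Vec
open import Function.Base using (_∘_)
open import Function.Bundles using (Bijection; Equivalence; _⇔_; mk⇔)
import Function.Construct.Composition as Compose
open import Level using (_⊔_)
open import Relation.Binary.PropositionalEquality using (_≡_; _≢_; refl; sym; trans; cong; cong₂; subst; setoid)
import Relation.Binary.Reasoning.Setoid as ≈-Reasoning
open import Relation.Nullary.Decidable using (Dec; yes; no; does; _×-dec_; ¬?; map′)
open import Relation.Nullary.Negation using (¬_; contradiction)
open import Relation.Unary using (Pred; Decidable; _≐_; _⊆_) renaming (_∈_ to _∈ᴾ_)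

open Equivalence using (to; from)

-- Finite sets of exponents

lookup-injective : ∀ {a} {A : Set a} {xs : List A} → Unique xs →
                   ∀ {i j} → List.lookup xs i ≡ List.lookup xs j → i ≡ j
lookup-injective (x∉ ∷ xs!) {zero}  {zero}  eq = refl
lookup-injective (x∉ ∷ xs!) {zero}  {suc j} eq = contradiction eq (All.lookup x∉ (∈-lookup j))
lookup-injective (x∉ ∷ xs!) {suc i} {zero}  eq = contradiction (sym eq) (All.lookup x∉ (∈-lookup i))
lookup-injective (x∉ ∷ xs!) {suc i} {suc j} eq = cong suc (lookup-injective xs! eq)

-- The position of an element is read off a proof of `P x`, yet equality on the subset ignores that
-- proof. Uniqueness of the list makes the position depend on x alone.
enumeration⇒cardinality : ∀ {a p} {A : Set a} {P : Pred A p} (xs : List A) → Unique xs →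
                          (∀ {x} → P x → x ∈ˡ xs) → (∀ {x} → x ∈ˡ xs → P x) →
                          HasCardinality P (length xs)
enumeration⇒cardinality {P = P} xs xs! P⇒∈ ∈⇒P = record
  { to        = position
  ; cong      = λ {x} {y} eq → lookup-injective xs!
                  (trans (sym (at-position x)) (trans eq (at-position y)))
  ; bijective = (λ {x} {y} eq → trans (at-position x) (trans (cong (List.lookup xs) eq) (sym (at-position y))))
              , λ i → (List.lookup xs i , ∈⇒P (∈-lookup i))
                    , λ {z} eq → lookup-injective xs! (trans (sym (at-position z)) eq)
  }
  where
  position : ∃ P → Fin (length xs)
  position (x , px) = index (P⇒∈ px)

  at-position : ∀ z → proj₁ z ≡ List.lookup xs (position z)
  at-position (x , px) = lookup-index (P⇒∈ px)

box : ∀ {n} → (Fin n → ℕ) → List (Vec ℕ n)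
box {zero}  b = [] ∷ []
box {suc n} b = cartesianProductWith _∷_ (upTo (b zero)) (box (b ∘ suc))

box-unique : ∀ {n} (b : Fin n → ℕ) → Unique (box b)
box-unique {zero}  b = [] ∷ []
box-unique {suc n} b =
  Unique.cartesianProductWith⁺ _∷_ Vec.∷-injective (Unique.upTo⁺ (b zero)) (box-unique (b ∘ suc))

∈-box : ∀ {n} {b : Fin n → ℕ} (e : Vec ℕ n) → (∀ i → lookup e i < b i) → e ∈ˡ box b
∈-box []      e<b = here refl
∈-box (x ∷ e) e<b = ∈-cartesianProductWith⁺ _∷_ (∈-upTo⁺ (e<b zero)) (∈-box e (e<b ∘ suc))

bounded⇒finite : ∀ {n p} {P : Pred (Vec ℕ n) p} → Decidable P → (b : Fin n → ℕ) →
                 (∀ {e} → P e → ∀ i → lookup e i < b i) → ∃[ k ] HasCardinality P k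
bounded⇒finite P? b bound = _ , enumeration⇒cardinality (filter P? (box b))
  (Unique.filter⁺ P? (box-unique b))
  (λ {e} pe → ∈-filter⁺ P? (∈-box e (bound pe)) pe)
  (proj₂ ∘ ∈-filter⁻ P? {xs = box b})

-- Divisibility of monomials

infix 4 _≼_

_≼_ : ∀ {n} → Vec ℕ n → Vec ℕ n → Set
e ≼ f = ∀ i → lookup e i ≤ lookup f i

_≼?_ : ∀ {n} (e f : Vec ℕ n) → Dec (e ≼ f)
e ≼? f = Fin.all? λ i → lookup e i ℕ.≤? lookup f i

lookup-⊕ : ∀ {n} (e f : Vec ℕ n) i → lookup (e ⊕ f) i ≡ lookup e i + lookup f i
lookup-⊕ e f i = Vec.lookup-zipWith _+_ i e f

≼-⊕ : ∀ {n} (g : Vec ℕ n) {e f} → e ≼ f → e ≼ g ⊕ f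
≼-⊕ g {f = f} e≼f i rewrite lookup-⊕ g f i = ℕ.≤-trans (e≼f i) (ℕ.m≤n+m _ _)

≼⇒⊕ : ∀ {n} (e f : Vec ℕ n) → e ≼ f → ∃[ g ] e ⊕ g ≡ f
≼⇒⊕ []      []      e≼f = [] , refl
≼⇒⊕ (x ∷ e) (y ∷ f) e≼f with ≼⇒⊕ e f (e≼f ∘ suc)
... | g , refl = y ∸ x ∷ g , cong (_∷ _) (ℕ.m+[n∸m]≡n (e≼f zero))

-- Written so that `x^ (unit i)` unfolds to `var i`.
unit : ∀ {n} → Fin n → Vec ℕ n
unit i = replicate _ 0 [ i ]≔ 1

lookup-unit : ∀ {n} (i : Fin n) → lookup (unit i) i ≡ 1
lookup-unit i = Vec.lookup∘update i (replicate _ 0) 1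

lookup-unit-≢ : ∀ {n} {i j : Fin n} → j ≢ i → lookup (unit i) j ≡ 0
lookup-unit-≢ {j = j} j≢i = trans (Vec.lookup∘update′ j≢i (replicate _ 0) 1) (Vec.lookup-replicate j 0)

unit-≼ : ∀ {n} (i : Fin n) {e : Vec ℕ n} → 1 ≤ lookup e i → unit i ≼ e
unit-≼ i 1≤eᵢ j with j Fin.≟ i
... | yes refl rewrite lookup-unit i    = 1≤eᵢ
... | no j≢i   rewrite lookup-unit-≢ j≢i = z≤n

-- Deleting an edge at the root

module _ {a p} {A : Set a} {P : Pred A p} (P? : Decidable P) where

  length-filter-removeAt-∈ : ∀ xs i → P (List.lookup xs i) →
    length (filter P? xs) ≡ suc (length (filter P? (removeAt xs i)))
  length-filter-removeAt-∈ (x ∷ xs) zero    px = cong length (List.filter-accept P? px)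
  length-filter-removeAt-∈ (x ∷ xs) (suc i) px with P? x
  ... | yes _ = cong suc (length-filter-removeAt-∈ xs i px)
  ... | no _  = length-filter-removeAt-∈ xs i px

  length-filter-removeAt-∉ : ∀ xs i → ¬ P (List.lookup xs i) →
    length (filter P? xs) ≡ length (filter P? (removeAt xs i))
  length-filter-removeAt-∉ (x ∷ xs) zero    ¬px = cong length (List.filter-reject P? ¬px)
  length-filter-removeAt-∉ (x ∷ xs) (suc i) ¬px with P? x
  ... | yes _ = cong suc (length-filter-removeAt-∉ xs i ¬px)
  ... | no _  = length-filter-removeAt-∉ xs i ¬px

Joins-unique : ∀ {n} {u v u′ v′ : Fin (suc n)} {e : Edge n} → Joins u v e → Joins u′ v′ e →
               (u′ ≡ u × v′ ≡ v) ⊎ (u′ ≡ v × v′ ≡ u)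
Joins-unique (inj₁ (refl , refl)) (inj₁ (refl , refl)) = inj₁ (refl , refl)
Joins-unique (inj₁ (refl , refl)) (inj₂ (refl , refl)) = inj₂ (refl , refl)
Joins-unique (inj₂ (refl , refl)) (inj₁ (refl , refl)) = inj₂ (refl , refl)
Joins-unique (inj₂ (refl , refl)) (inj₂ (refl , refl)) = inj₁ (refl , refl)

lookup-mExponent : ∀ {n} (G : Multigraph n) A i →
                   lookup (mExponent G A) i ≡ (if does (i ∈? A) then d G A i else 0)
lookup-mExponent G A = Vec.lookup∘tabulate _

lookup-mExponent-∈ : ∀ {n} (G : Multigraph n) {A i} → i ∈ A → lookup (mExponent G A) i ≡ d G A i
lookup-mExponent-∈ G {A} {i} i∈A with lookup-mExponent G A i
... | eq with i ∈? A
...   | yes _   = eq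
...   | no i∉A = contradiction i∈A i∉A

lookup-mExponent-∉ : ∀ {n} (G : Multigraph n) {A i} → i ∉ A → lookup (mExponent G A) i ≡ 0
lookup-mExponent-∉ G {A} {i} i∉A with lookup-mExponent G A i
... | eq with i ∈? A
...   | yes i∈A = contradiction i∈A i∉A
...   | no _    = eq

module RootEdge {n} (G : Multigraph n) (e₀ : EdgeIndex G) (l : Fin n)
                (e₀-joins : Joins root (vertex l) (edge G e₀)) where

  G′ : Multigraph n
  G′ = G -ₑ e₀

  a-removed : a G (vertex l) root ≡ suc (a G′ (vertex l) root)
  a-removed = length-filter-removeAt-∈ (joins? (vertex l) root) (edges G) e₀ (swap e₀-joins)

  a-kept : ∀ {i v} → ¬ (i ≡ l × v ≡ root) → a G (vertex i) v ≡ a G′ (vertex i) v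
  a-kept {i} {v} ≢e₀ = length-filter-removeAt-∉ (joins? (vertex i) v) (edges G) e₀ not-joins
    where
    not-joins : ¬ Joins (vertex i) v (edge G e₀)
    not-joins joins with Joins-unique {e = edge G e₀} e₀-joins joins
    -- The `inj₁` case would equate `vertex i` with the root, so it is absent.
    ... | inj₂ (refl , v≡root) = ≢e₀ (refl , v≡root)

  -- The root is never in `outside ∷ A`, so for every A it survives the filter and heads the sum.
  -- Only this first summand counts e₀.
  d-removed : ∀ A → d G A l ≡ suc (d G′ A l)
  d-removed A = cong₂ _+_ a-removed (cong ℕ.sum (List.map-cong-local nonroot-kept))
    where
    nonroot-kept : All (λ v → a G (vertex l) v ≡ a G′ (vertex l) v)
                       (filter (_∈? ∁ (outside ∷ A)) (List.tabulate suc))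
    nonroot-kept = All.filter⁺ (_∈? ∁ (outside ∷ A)) (All.tabulate⁺ {f = suc} λ _ → a-kept λ ())

  d-kept : ∀ A {i} → i ≢ l → d G A i ≡ d G′ A i
  d-kept A {i} i≢l = cong ℕ.sum (List.map-cong {f = a G (vertex i)} {g = a G′ (vertex i)}
    (λ _ → a-kept (i≢l ∘ proj₁)) (filter (_∈? ∁ (outside ∷ A)) (allFin (suc n))))

  -- Holds in each coordinate separately. At l in A, the unit lost with e₀ matches the unit
  -- contributed by the factor at l.
  mExponent-≼-shift : ∀ A {e} → mExponent G A ≼ unit l ⊕ e ⇔ mExponent G′ A ≼ e
  mExponent-≼-shift A {e} = mk⇔ (λ ≼e j → to (at j) (≼e j)) (λ ≼e j → from (at j) (≼e j))
    where
    at : ∀ j → lookup (mExponent G A) j ≤ lookup (unit l ⊕ e) j ⇔ lookup (mExponent G′ A) j ≤ lookup e j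
    at j rewrite lookup-⊕ (unit l) e j with j ∈? A | j Fin.≟ l
    -- This includes `j ≡ l`: the extra factor gains nothing there, since both exponents are 0.
    ... | no j∉A  | _ rewrite lookup-mExponent-∉ G j∉A | lookup-mExponent-∉ G′ j∉A =
      mk⇔ (λ _ → z≤n) (λ _ → z≤n)
    ... | yes j∈A | yes refl
      rewrite lookup-mExponent-∈ G j∈A | lookup-mExponent-∈ G′ j∈A | d-removed A | lookup-unit l =
      mk⇔ s≤s⁻¹ s≤s
    ... | yes j∈A | no j≢l
      rewrite lookup-mExponent-∈ G j∈A | lookup-mExponent-∈ G′ j∈A | d-kept A j≢l | lookup-unit-≢ j≢l =
      mk⇔ (λ le → le) (λ le → le)

-- Monomial ideals

-- The up-set of the exponents `E i`. Keeping the index predicate T apart from `E` lets `G` and `G′`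
-- share T and differ only in `E`.
AboveSome : ∀ {i t n} {I : Set i} → Pred I t → (I → Vec ℕ n) → Pred (Vec ℕ n) (i ⊔ t)
AboveSome T E e = ∃[ i ] T i × E i ≼ e

module MonomialIdeals {c ℓ} (K : CommutativeRing c ℓ) (n : ℕ) where
  private module K = CommutativeRing K
  open PolynomialRing K n
  open Ideals ring
  open CommutativeRing ring using (*-comm)
  open ≈-Reasoning K.setoid

  ⟨⟩-mono : ∀ {p q} {S : Pred Poly p} {T : Pred Poly q} → S ⊆ T → ⟨ S ⟩ ⊆ ⟨ T ⟩
  ⟨⟩-mono S⊆T (⟨⟩-gen s)     = ⟨⟩-gen (S⊆T s)
  ⟨⟩-mono S⊆T ⟨⟩-0           = ⟨⟩-0
  ⟨⟩-mono S⊆T (⟨⟩-+ x y)     = ⟨⟩-+ (⟨⟩-mono S⊆T x) (⟨⟩-mono S⊆T y)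
  ⟨⟩-mono S⊆T (⟨⟩-* r x)     = ⟨⟩-* r (⟨⟩-mono S⊆T x)
  ⟨⟩-mono S⊆T (⟨⟩-resp eq x) = ⟨⟩-resp eq (⟨⟩-mono S⊆T x)

  δ-≡ : ∀ k e → δ (k , e) e ≡ k
  δ-≡ k e with e ≟ᵉ e
  ... | yes _  = refl
  ... | no e≢e = contradiction refl e≢e

  δ-≢ : ∀ k {e f} → f ≢ e → δ (k , f) e ≡ K.0#
  δ-≢ k {e} {f} f≢e with f ≟ᵉ e
  ... | yes f≡e = contradiction f≡e f≢e
  ... | no _    = refl

  coeff-x^ : ∀ e → coeff (x^ e) e K.≈ K.1#
  coeff-x^ e = K.trans (K.+-identityʳ _) (K.reflexive (δ-≡ K.1# e))

  coeff-*-x^ : ∀ z e f → coeff (z *ᴾ (x^ e)) f K.≈ coeff (map ((K.1# , e) *ᵀ_) z) f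
  coeff-*-x^ z e f = K.trans (coeff-≈ (*-comm z (x^ e)) f)
    (K.reflexive (cong (λ p → coeff p f) (List.++-identityʳ (map ((K.1# , e) *ᵀ_) z))))

  coeff-*-x^-⊕ : ∀ z e f → coeff (z *ᴾ (x^ e)) (e ⊕ f) K.≈ coeff z f
  coeff-*-x^-⊕ z e f = begin
    coeff (z *ᴾ (x^ e)) (e ⊕ f)               ≈⟨ coeff-*-x^ z e (e ⊕ f) ⟩
    coeff (map ((K.1# , e) *ᵀ_) z) (e ⊕ f)  ≈⟨ coeff-scale K.1# e z f ⟩
    K.1# K.* coeff z f                      ≈⟨ K.*-identityˡ _ ⟩
    coeff z f                               ∎

  -- Multiplication by `x^ e` moves the coefficient at f to `e ⊕ f`, so every coefficient of z can
  -- be read off the product. This gives the injectivity of `μ`.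
  *-x^-cancelʳ : ∀ e {z w} → z *ᴾ (x^ e) ≈ᴾ w *ᴾ (x^ e) → z ≈ᴾ w
  *-x^-cancelʳ e {z} {w} eq = mk≈ λ f → begin
    coeff z f                    ≈⟨ coeff-*-x^-⊕ z e f ⟨
    coeff (z *ᴾ (x^ e)) (e ⊕ f)  ≈⟨ coeff-≈ eq (e ⊕ f) ⟩
    coeff (w *ᴾ (x^ e)) (e ⊕ f)  ≈⟨ coeff-*-x^-⊕ w e f ⟩
    coeff w f                    ∎

  -- The swapped order on the right fits `ε ⊕ P`, the form in which the shift lemmas are stated.
  x^-* : ∀ e f → (x^ e) *ᴾ (x^ f) ≈ᴾ (x^ (f ⊕ e))
  x^-* e f = mk≈ λ g → K.+-congʳ (δ-cong {K.1# K.* K.1# , e ⊕ f} (K.*-identityˡ _ , ⊕-comm e f) g)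

  -- The support of p lies in U, phrased without deciding whether a coefficient is zero.
  VanishesOff : ∀ {p} → Pred Exponent p → Poly → Set (ℓ ⊔ p)
  VanishesOff U p = ∀ e → ¬ U e → coeff p e K.≈ K.0#

  -- A term with exponent f contributes at e only if `e ≡ f ⊕ g`. If e is outside U, then so is g,
  -- because U is closed under adding exponents.
  vanishesOff-* : ∀ {p} {U : Pred Exponent p} → (∀ g {e} → U e → U (g ⊕ e)) →
                  ∀ r {q} → VanishesOff U q → VanishesOff U (r *ᴾ q)
  vanishesOff-* U-up []            q↓ e ¬u = K.refl
  vanishesOff-* U-up ((k , f) ∷ r) {q} q↓ e ¬u = begin
    coeff (map ((k , f) *ᵀ_) q List.++ r *ᴾ q) e          ≈⟨ coeff-++ (map ((k , f) *ᵀ_) q) (r *ᴾ q) e ⟩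
    coeff (map ((k , f) *ᵀ_) q) e K.+ coeff (r *ᴾ q) e    ≈⟨ K.+-cong scaled (vanishesOff-* U-up r q↓ e ¬u) ⟩
    K.0# K.+ K.0#                                         ≈⟨ K.+-identityˡ _ ⟩
    K.0#                                                  ∎
    where
    scaled : coeff (map ((k , f) *ᵀ_) q) e K.≈ K.0#
    scaled with subtract? f e
    ... | no ¬∃          = coeff-scale-0 k f q e ¬∃
    ... | yes (g , refl) = begin
      coeff (map ((k , f) *ᵀ_) q) (f ⊕ g)  ≈⟨ coeff-scale k f q g ⟩
      k K.* coeff q g                      ≈⟨ K.*-congˡ (q↓ g (¬u ∘ U-up f)) ⟩
      k K.* K.0#                           ≈⟨ K.zeroʳ k ⟩
      K.0#                                 ∎

  module _ {i t} {I : Set i} (T : Pred I t) (E : I → Exponent) where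

    Generators : Pred Poly (c ⊔ i ⊔ t)
    Generators z = ∃[ j ] T j × z ≡ (x^ E j)

    ∈⟨⟩⇒vanishes : ∀ {z} → z ∈ᴾ ⟨ Generators ⟩ → VanishesOff (AboveSome T E) z
    ∈⟨⟩⇒vanishes (⟨⟩-gen (j , tj , refl)) e ¬u =
      K.trans (K.+-identityʳ _) (K.reflexive (δ-≢ K.1# {e} {E j} λ where refl → ¬u (j , tj , λ _ → ℕ.≤-refl)))
    ∈⟨⟩⇒vanishes ⟨⟩-0 e ¬u = K.refl
    ∈⟨⟩⇒vanishes (⟨⟩-+ {x} {y} x∈ y∈) e ¬u = begin
      coeff (x +ᴾ y) e         ≈⟨ coeff-++ x y e ⟩
      coeff x e K.+ coeff y e  ≈⟨ K.+-cong (∈⟨⟩⇒vanishes x∈ e ¬u) (∈⟨⟩⇒vanishes y∈ e ¬u) ⟩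
      K.0# K.+ K.0#            ≈⟨ K.+-identityˡ _ ⟩
      K.0#                     ∎
    ∈⟨⟩⇒vanishes (⟨⟩-* r x∈) = vanishesOff-*
      (λ g (j , tj , Ej≼e) → j , tj , ≼-⊕ g {E j} Ej≼e) r (∈⟨⟩⇒vanishes x∈)
    ∈⟨⟩⇒vanishes (⟨⟩-resp x≈y x∈) e ¬u = K.trans (K.sym (coeff-≈ x≈y e)) (∈⟨⟩⇒vanishes x∈ e ¬u)

    term∈⟨⟩ : ∀ k {e} → AboveSome T E e → ((k , e) ∷ []) ∈ᴾ ⟨ Generators ⟩
    term∈⟨⟩ k {e} (j , tj , Ej≼e) with ≼⇒⊕ (E j) e Ej≼e
    ... | g , refl = ⟨⟩-resp
      (mk≈ λ f → K.+-congʳ (δ-cong {k K.* K.1# , g ⊕ E j} (K.*-identityʳ k , ⊕-comm g (E j)) f))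
      (⟨⟩-* ((k , g) ∷ []) (⟨⟩-gen (j , tj , refl)))

    module _ (above? : Decidable (AboveSome T E)) where

      restrict : Poly → Poly
      restrict = filter (above? ∘ proj₂)

      restrict∈⟨⟩ : ∀ p → restrict p ∈ᴾ ⟨ Generators ⟩
      restrict∈⟨⟩ []            = ⟨⟩-0
      restrict∈⟨⟩ ((k , e) ∷ p) with above? e
      ... | yes u = ⟨⟩-+ (term∈⟨⟩ k u) (restrict∈⟨⟩ p)
      ... | no _  = restrict∈⟨⟩ p

      coeff-restrict : ∀ p {e} → AboveSome T E e → coeff (restrict p) e K.≈ coeff p e
      coeff-restrict []            u = K.refl
      coeff-restrict ((k , f) ∷ p) {e} u with above? f
      ... | yes _ = K.+-congˡ (coeff-restrict p u)
      ... | no ¬u = begin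
        coeff (restrict p) e          ≈⟨ coeff-restrict p u ⟩
        coeff p e                     ≈⟨ K.+-identityˡ _ ⟨
        K.0# K.+ coeff p e            ≡⟨ cong (K._+ coeff p e) (δ-≢ k {e} {f} λ where refl → ¬u u) ⟨
        δ (k , f) e K.+ coeff p e     ∎

      -- The list z may still contain terms off the up-set, but their coefficients sum to zero at
      -- each exponent. Dropping them gives an equal polynomial, each of whose terms is a multiple
      -- of a generator.
      vanishes⇒∈⟨⟩ : ∀ {z} → VanishesOff (AboveSome T E) z → z ∈ᴾ ⟨ Generators ⟩
      vanishes⇒∈⟨⟩ {z} z↓ = ⟨⟩-resp (mk≈ restrict≈) (restrict∈⟨⟩ z)
        where
        restrict≈ : ∀ e → coeff (restrict z) e K.≈ coeff z e
        restrict≈ e with above? e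
        ... | yes u = coeff-restrict z u
        ... | no ¬u = K.trans (∈⟨⟩⇒vanishes (restrict∈⟨⟩ z) e ¬u) (K.sym (z↓ e ¬u))

      -- Over the zero ring every `x^ e` is zero and lies in every ideal, hence the hypothesis.
      -- Decidability of domination turns the contradiction into an actual generator.
      x^∈⟨⟩⇔ : ¬ (K.1# K.≈ K.0#) → ∀ {e} → (x^ e) ∈ᴾ ⟨ Generators ⟩ ⇔ AboveSome T E e
      x^∈⟨⟩⇔ 1≉0 {e} = mk⇔ above (term∈⟨⟩ K.1#)
        where
        above : (x^ e) ∈ᴾ ⟨ Generators ⟩ → AboveSome T E e
        above x^e∈ with above? e
        ... | yes u = u
        ... | no ¬u = contradiction
          (K.trans (K.sym (coeff-x^ e)) (∈⟨⟩⇒vanishes x^e∈ e ¬u)) 1≉0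

  module _ {i t} {I : Set i} (T : Pred I t) (E E′ : I → Exponent)
           (above? : Decidable (AboveSome T E)) (above′? : Decidable (AboveSome T E′))
           (g : Exponent) (shift : ∀ {e} → AboveSome T E (g ⊕ e) ⇔ AboveSome T E′ e) where

    -- Membership on either side is a vanishing condition. The coefficient of z at f is that of the
    -- product at `g ⊕ f`, and `shift` matches the two up-sets under this translation.
    ⟨⟩-colon : ⟨ Generators T E′ ⟩ ≐ (⟨ Generators T E ⟩ ∶ (x^ g))
    ⟨⟩-colon = (λ {z} z∈ → vanishes⇒∈⟨⟩ T E above? (product-vanishes z (∈⟨⟩⇒vanishes T E′ z∈)))
             , (λ {z} zx∈ → vanishes⇒∈⟨⟩ T E′ above′? λ e ¬u →
                 K.trans (K.sym (coeff-*-x^-⊕ z g e)) (∈⟨⟩⇒vanishes T E zx∈ (g ⊕ e) (¬u ∘ to shift)))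
      where
      product-vanishes : ∀ z → VanishesOff (AboveSome T E′) z → VanishesOff (AboveSome T E) (z *ᴾ (x^ g))
      product-vanishes z z↓ e ¬u with subtract? g e
      ... | yes (f , refl) = K.trans (coeff-*-x^-⊕ z g f) (z↓ f (¬u ∘ from shift))
      -- An exponent that g does not divide cannot occur in the product.
      ... | no ¬∃          = K.trans (coeff-*-x^ z g e) (coeff-scale-0 K.1# g z e ¬∃)

-- Spherical parking functions

AtMost : ∀ {n} → ℕ → Pred (Subset n) _
AtMost k A = Nonempty A × ∣ A ∣ ≤ suc k

above? : ∀ {n t} {T : Pred (Subset n) t} → Decidable T →
         ∀ (E : Subset n → Vec ℕ n) → Decidable (AboveSome T E)
above? T? E e = anySubset? λ A → T? A ×-dec (E A ≼? e)

nonempty-above? : ∀ {n} (G : Multigraph n) → Decidable (AboveSome Nonempty (mExponent G))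
nonempty-above? G = above? nonempty? (mExponent G)

atMost-above? : ∀ {n} k (G : Multigraph n) → Decidable (AboveSome (AtMost k) (mExponent G))
atMost-above? k G = above? (λ A → nonempty? A ×-dec (∣ A ∣ ℕ.≤? suc k)) (mExponent G)

∉⇒∣∣<n : ∀ {n} {A : Subset n} {i} → i ∉ A → ∣ A ∣ < n
∉⇒∣∣<n {n} {A} {i} i∉A = subst (∣ A ∣ <_) (∣⊤∣≡n n) (p⊂q⇒∣p∣<∣q∣ (⊆⊤ , i , ∈⊤ , i∉A))

-- The combinatorial form of `sPF`: no field is involved, and the condition is decidable.
Spherical : ∀ {n} → Multigraph n → Pred (Vec ℕ n) _
Spherical {n} G P = AboveSome Nonempty (mExponent G) P × ¬ AboveSome (AtMost (n ∸ 2)) (mExponent G) P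

-- The generator of a singleton is a power of one variable, and a singleton is small enough to be
-- excluded because `suc (n ∸ 2)` is at least 1.
spherical-< : ∀ {n} (G : Multigraph n) {P} → Spherical G P → ∀ i → lookup P i < d G ⁅ i ⁆ i
spherical-< {n} G {P} (_ , ¬small) i = ℕ.≰⇒> λ d≤Pᵢ → ¬small
  (⁅ i ⁆ , ((i , x∈⁅x⁆ i) , subst (_≤ suc (n ∸ 2)) (sym (∣⁅x⁆∣≡1 i)) (s≤s z≤n)) , divides d≤Pᵢ)
  where
  divides : d G ⁅ i ⁆ i ≤ lookup P i → mExponent G ⁅ i ⁆ ≼ P
  divides d≤Pᵢ j with j ∈? ⁅ i ⁆
  ... | no j∉  rewrite lookup-mExponent-∉ G j∉ = z≤n
  ... | yes j∈ rewrite x∈⁅y⁆⇒x≡y i j∈ | lookup-mExponent-∈ G (x∈⁅x⁆ i) = d≤Pᵢ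

module SphericalShift {n} (2≤n : 2 ≤ n) (G : Multigraph n) (e₀ : EdgeIndex G) (l : Fin n)
                      (e₀-joins : Joins root (vertex l) (edge G e₀)) where
  open RootEdge G e₀ l e₀-joins public

  -- The same A witnesses both sides, so any restriction T on A passes through.
  above-shift : ∀ {t} {T : Pred (Subset n) t} {e} →
                AboveSome T (mExponent G) (unit l ⊕ e) ⇔ AboveSome T (mExponent G′) e
  above-shift = mk⇔ (λ (A , tA , ≼e) → A , tA , to (mExponent-≼-shift A) ≼e)
                    (λ (A , tA , ≼e) → A , tA , from (mExponent-≼-shift A) ≼e)

  spherical-shift : ∀ {P} → Spherical G (unit l ⊕ P) ⇔ Spherical G′ P
  spherical-shift = mk⇔ (λ (u , ¬v) → to above-shift u , ¬v ∘ from above-shift)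
                        (λ (u , ¬v) → from above-shift u , ¬v ∘ to above-shift)

  -- A dominating A must contain l, since otherwise it has at most n - 1 elements and is excluded.
  -- Then e₀ makes its exponent at l positive.
  spherical-positive : ∀ {P} → Spherical G P → unit l ≼ P
  spherical-positive {P} ((A , A≠∅ , m≼P) , ¬small) = unit-≼ l {P}
    (ℕ.≤-trans (subst (1 ≤_) (sym (trans (lookup-mExponent-∈ G l∈A) (d-removed A))) (s≤s z≤n)) (m≼P l))
    where
    l∈A : l ∈ A
    l∈A with l ∈? A
    ... | yes l∈A = l∈A
    ... | no l∉A  = contradiction (A , (A≠∅ , ∣A∣≤n-1) , m≼P) ¬small
      where
      ∣A∣≤n-1 : ∣ A ∣ ≤ suc (n ∸ 2)
      -- With `2 ≤ n`, n equals `2 + (n ∸ 2)`, so the strict bound by n loses one successor to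
      -- become the bound by `suc (n ∸ 2)`.
      ∣A∣≤n-1 = s≤s⁻¹ (subst (suc ∣ A ∣ ≤_) (sym (ℕ.m+[n∸m]≡n 2≤n)) (∉⇒∣∣<n l∉A))

lemma3p1 : ∀ {c ℓ₁ ℓ₂} (𝕂 : HeytingField c ℓ₁ ℓ₂) (n : ℕ) (2≤n : 2 ≤ n)
    (G : Multigraph n) → Connected G →
    (e₀ : EdgeIndex G) → Joins root (vertex (last 2≤n)) (edge G e₀) →
    let open Parking 𝕂 n
        G′ = G -ₑ e₀
        xₙ = var (last 2≤n)
    in (𝓜 G′ ≐ (𝓜 G ∶ xₙ))
     × (Σ[ μ ∈ Bijection (monomialSetoid (sPF G′)) (monomialSetoid (sPF G)) ]
          (∀ z → proj₁ (Bijection.to μ z) ≈ᴾ (proj₁ z *ᴾ xₙ)))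
     × (∃[ k ] (HasCardinality (sPF G) k × HasCardinality (sPF G′) k))
lemma3p1 𝕂 n 2≤n G _ e₀ e₀-joins =
    ⟨⟩-colon Nonempty (mExponent G) (mExponent G′) (nonempty-above? G) (nonempty-above? G′) ε above-shift
  , (μ , λ _ → R.refl)
  -- The enumeration is made for `G` only; `G′` gets the same k by first shifting into `sPF G`.
  , proj₁ finite , proj₂ finite , Compose.bijection sPF-shift-bijection (proj₂ finite)
  where
  open Parking 𝕂 n
  module 𝕂 = HeytingField 𝕂
  module R = CommutativeRing R
  open MonomialIdeals (HeytingCommutativeRing.commutativeRing 𝕂.heytingCommutativeRing) n
  open SphericalShift 2≤n G e₀ (last 2≤n) e₀-joins

  ε : Exponent
  ε = unit (last 2≤n)

  1≉0 : ¬ (𝕂.1# 𝕂.≈ 𝕂.0#)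
  1≉0 1≈0 = 𝕂.#-irrefl 1≈0 (HeytingProperties.1#0 𝕂.heytingCommutativeRing)

  𝓜⇔ : ∀ H {P} → (x^ P) ∈ᴾ 𝓜 H ⇔ AboveSome Nonempty (mExponent H) P
  𝓜⇔ H = x^∈⟨⟩⇔ Nonempty (mExponent H) (nonempty-above? H) 1≉0

  -- The two generating sets differ only in the bracketing of the conditions on A, which `⟨⟩-mono`
  -- bridges in both directions.
  𝓜⁽⁾⇔ : ∀ k H {P} → (x^ P) ∈ᴾ 𝓜⁽ k ⁾ H ⇔ AboveSome (AtMost k) (mExponent H) P
  𝓜⁽⁾⇔ k H = mk⇔
    (to x^∈⇔ ∘ ⟨⟩-mono (λ (A , A≠∅ , ∣A∣≤ , eq) → A , (A≠∅ , ∣A∣≤) , eq))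
    (⟨⟩-mono (λ (A , (A≠∅ , ∣A∣≤) , eq) → A , A≠∅ , ∣A∣≤ , eq) ∘ from x^∈⇔)
    where
    x^∈⇔ : ∀ {P} → _ ⇔ _
    x^∈⇔ {P} = x^∈⟨⟩⇔ (AtMost k) (mExponent H) (atMost-above? k H) 1≉0 {P}

  sPF⇔ : ∀ H {P} → sPF H P ⇔ Spherical H P
  sPF⇔ H = mk⇔ (λ (u , ¬v) → to (𝓜⇔ H) u , ¬v ∘ from (𝓜⁽⁾⇔ _ H))
               (λ (u , ¬v) → from (𝓜⇔ H) u , ¬v ∘ to (𝓜⁽⁾⇔ _ H))

  sPF? : ∀ H → Decidable (sPF H)
  sPF? H P = map′ (from (sPF⇔ H)) (to (sPF⇔ H)) (nonempty-above? H P ×-dec ¬? (atMost-above? _ H P))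

  sPF-shift : ∀ {P} → sPF G (ε ⊕ P) ⇔ sPF G′ P
  sPF-shift = mk⇔ (from (sPF⇔ G′) ∘ to spherical-shift ∘ to (sPF⇔ G))
                  (from (sPF⇔ G) ∘ from spherical-shift ∘ to (sPF⇔ G′))

  sPF-positive : ∀ {Q} → sPF G Q → ∃[ P ] ε ⊕ P ≡ Q
  sPF-positive {Q} Q∈ = ≼⇒⊕ ε Q (spherical-positive {Q} (to (sPF⇔ G) Q∈))

  μ : Bijection (monomialSetoid (sPF G′)) (monomialSetoid (sPF G))
  μ = record
    { to        = λ (z , P , P∈ , z≈) →
        -- Here z is any representative of `x^ P`, so z itself is multiplied, and the formula for
        -- `μ` then holds by reflexivity.
        z *ᴾ (x^ ε) , ε ⊕ P , from sPF-shift P∈ , R.trans (R.*-congʳ z≈) (x^-* P ε)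
    ; cong      = R.*-congʳ
    ; bijective = *-x^-cancelʳ ε , surjective
    }
    where
    surjective : ∀ y → _
    surjective (y , Q , Q∈ , y≈) with sPF-positive Q∈
    ... | P , refl = ((x^ P) , P , to sPF-shift Q∈ , R.refl)
                   , λ z≈ → R.trans (R.*-congʳ z≈) (R.trans (x^-* P ε) (R.sym y≈))

  -- The exponent counterpart of `μ`: cardinality counts exponent vectors under propositional
  -- equality, not polynomials.
  sPF-shift-bijection : Bijection (subsetSetoid (setoid Exponent) (sPF G′)) (subsetSetoid (setoid Exponent) (sPF G))
  sPF-shift-bijection = record
    { to        = λ (P , P∈) → ε ⊕ P , from sPF-shift P∈
    ; cong      = cong (ε ⊕_)
    ; bijective = ⊕-cancelˡ ε _ _ , surjective
    }
    where
    surjective : ∀ y → _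
    surjective (Q , Q∈) with sPF-positive Q∈
    ... | P , refl = (P , to sPF-shift Q∈) , cong (ε ⊕_)

  finite : ∃[ k ] HasCardinality (sPF G) k
  finite = bounded⇒finite (sPF? G) (λ i → d G ⁅ i ⁆ i) (λ {P} → spherical-< G {P} ∘ to (sPF⇔ G))
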